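{- For integers $k\geq 2$ and $n\geq 4$, \[ \mathrm{R}_k(W_n)\leq k\bigl(\mathrm{R}(C_{n-1}, \underbrace{W_n, \ldots , W_n}_{k-1})-1\bigr)+2 \leq k\bigl(\mathrm{R}(C_{n-1},K_{\mathrm{R}_{k-1}(W_n)})-1\bigr)+2, \] and moreover \[ \mathrm{R}_k(W_n)\leq k\left(\frac{n-3}{2}\mathrm{R}_{k-1}(W_n)\cdot (\mathrm{R}_{k-1}(W_n)-1)+\mathrm{R}_{k-1}(W_n)-1\right)+2. \]
   Context: For an integer $n\geq 4$, the wheel $W_n$ is the graph on $n$ vertices obtained from the cycle $C_{n-1}$ by adding one new vertex adjacent to every vertex of the cycle; $C_m$ is the cycle of length $m$ and $K_m$ the complete graph on $m$ vertices. For graphs $G_1,\ldots,G_k$, $\mathrm{R}(G_1,\ldots,G_k)$ is the smallest integer $N$ such that for every coloring of the edges of $K_N$ with colors $1,\ldots,k$ there is some $i$ and a copy of $G_i$ all of whose edges have color $i$. $\mathrm{R}_k(G)$ denotes $\mathrm{R}(G,\ldots,G)$ with $k$ copies of $G$; in particular $\mathrm{R}(C_{n-1},K_t)$ is the two-color Ramsey number. -}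

module Defs where

open import Data.Nat using (ℕ; zero; suc; _≤_)
open import Data.Fin using (Fin; zero; suc; toℕ)
open import Data.Product using (Σ; _×_; ∃)
open import Data.Sum using (_⊎_)
open import Data.Unit using (⊤)
open import Data.Empty using (⊥)
open import Relation.Binary.PropositionalEquality using (_≡_; _≢_)
open import Function.Definitions using (Injective)

-- A (simple, finite) graph: vertex set Fin V with an edge relation.
-- Only the edges matter for "containing a copy"; the relations below
-- are symmetric and irreflexive.
record Graph : Set₁ where
  field
    V : ℕ
    E : Fin V → Fin V → Set
open Graph public

-- adjacency of the cycle 0 - 1 - ... - (m-1) - 0 on Fin m  (a cycle for m ≥ 3)
CycAdj : (m : ℕ) → Fin m → Fin m → Set
CycAdj m u v =
  (suc (toℕ u) ≡ toℕ v) ⊎ (suc (toℕ v) ≡ toℕ u)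
  ⊎ (toℕ u ≡ 0 × suc (toℕ v) ≡ m) ⊎ (toℕ v ≡ 0 × suc (toℕ u) ≡ m)

Cycle : ℕ → Graph
Cycle m = record { V = m ; E = CycAdj m }

Complete : ℕ → Graph
Complete t = record { V = t ; E = λ u v → u ≢ v }

WheelAdj : (m : ℕ) → Fin (suc m) → Fin (suc m) → Set
WheelAdj m zero zero = ⊥
WheelAdj m zero (suc j) = ⊤
WheelAdj m (suc i) zero = ⊤
WheelAdj m (suc i) (suc j) = CycAdj m i j

-- the wheel W_n on n vertices (n ≥ 4 in all uses): C_{n-1} plus a hub
Wheel : ℕ → Graph
Wheel zero = record { V = zero ; E = λ _ _ → ⊥ }
Wheel (suc m) = record { V = suc m ; E = WheelAdj m }

-- A k-colouring c (of the edges of K_N, given as a symmetric function on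
-- pairs; diagonal values are irrelevant) contains a copy of G in colour i.
MonoCopy : {N k : ℕ} → (Fin N → Fin N → Fin k) → Fin k → Graph → Set
MonoCopy {N} c i G =
  Σ (Fin (V G) → Fin N) λ f →
    Injective _≡_ _≡_ f × (∀ u v → E G u v → c (f u) (f v) ≡ i)

Arrows : (N k : ℕ) → (Fin k → Graph) → Set
Arrows N k Gs =
  (c : Fin N → Fin N → Fin k) → (∀ x y → c x y ≡ c y x) →
  ∃ λ (i : Fin k) → MonoCopy c i (Gs i)

IsRamsey : (k : ℕ) → (Fin k → Graph) → ℕ → Set
IsRamsey k Gs r = Arrows r k Gs × (∀ N → Arrows N k Gs → r ≤ N)

firstThen : Graph → Graph → {k : ℕ} → Fin k → Graph
firstThen G H zero = G
firstThen G H (suc _) = H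

pair : Graph → Graph → Fin 2 → Graph
pair G H = firstThen G H

const : Graph → {k : ℕ} → Fin k → Graph
const G _ = G

{-# OPTIONS --safe #-}

-- The hub of W_n is an arbitrary vertex: by pigeonhole it sends at least R(C_{n-1}, W_n, ...) edges
-- of one colour i, and inside that neighbourhood a cycle of colour i closes up to a wheel.
-- Merging all colours but the first shows R(C_{n-1}, W_n, ...) ≤ R(C_{n-1}, K_{R_{k-1}(W_n)}).
-- Finally R(C_{q+2}, K_t) ≤ q (t choose 2) + t by induction on t: a vertex with more than q t
-- neighbours has a path on q + 1 vertices or t + 1 independent vertices among them
-- (R(P_{q+1}, K_{t+1}) ≤ q t + 1), and otherwise its non-neighbours are numerous enough for
-- the induction hypothesis.
module Submission where

open import Defs
open import Data.Bool using (true; false)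
open import Data.Empty using (⊥)
open import Data.Fin using (Fin; zero; suc; toℕ; inject≤)
open import Data.Fin.Permutation.Components using (transpose; transpose-inverse)
import Data.Fin.Properties as Fin
open import Data.List using (List; []; _∷_; length; lookup; filter; allFin)
open import Data.List.Membership.Propositional using (_∈_; find)
open import Data.List.Membership.Propositional.Properties using (∈-∃++; ∈-allFin; ∈-lookup)
open import Data.List.Properties using (length-tabulate)
open import Data.List.Relation.Binary.Permutation.Propositional using (_↭_; ↭-sym; ↭⇒↭ₛ; ↭-reflexive; ↭-trans)
open import Data.List.Relation.Binary.Permutation.Propositional.Properties using (shift; ↭-length; ∈-resp-↭)
import Data.List.Relation.Binary.Permutation.Setoid.Properties as Permₛ
open import Data.List.Relation.Binary.Subset.Propositional using (_⊆_)
open import Data.List.Relation.Binary.Subset.Propositional.Properties using (filter-⊆; ∷⁺ʳ)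
open import Data.List.Relation.Unary.All as All using (All; []; _∷_)
open import Data.List.Relation.Unary.All.Properties using (all-filter; ¬Any⇒All¬; anti-mono)
open import Data.List.Relation.Unary.AllPairs using (AllPairs; []; _∷_)
open import Data.List.Relation.Unary.Any using (Any; here; there; any?)
open import Data.List.Relation.Unary.Linked using (Linked; []; [-]; _∷_)
open import Data.List.Relation.Unary.Unique.Propositional using (Unique)
open import Data.List.Relation.Unary.Unique.Propositional.Properties using (allFin⁺; filter⁺)
open import Data.Nat using (ℕ; zero; suc; _≤_; _<_; _+_; _*_; _∸_; _/_; z≤n; s≤s; s≤s⁻¹; _≤?_)
open import Data.Nat.DivMod using (m*n/n≡m)
open import Data.Nat.Properties hiding (_≟_)
open import Data.Nat.Tactic.RingSolver using (solve-∀)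
open import Data.Product using (∃; ∃₂; _×_; _,_; proj₁; proj₂)
open import Data.Sum as Sum using (_⊎_; inj₁; inj₂)
open import Function using (_∘_; id)
open import Function.Definitions using (Injective)
open import Relation.Binary.Definitions using (Decidable; DecidableEquality; Symmetric)
open import Relation.Binary.PropositionalEquality
open import Relation.Nullary using (¬_; yes; no; does; contradiction; decidable-stable)
open import Relation.Unary.Properties using (∁?)
open import Relation.Unary using () renaming (Decidable to Decidable₁)

-- Lists as finite sets

module _ {A : Set} where

  length-filter-∁ : {P : A → Set} (P? : Decidable₁ P) (xs : List A) →
                    length (filter P? xs) + length (filter (∁? P?) xs) ≡ length xs
  length-filter-∁ P? [] = refl
  length-filter-∁ P? (x ∷ xs) with does (P? x)
  ... | true  = cong suc (length-filter-∁ P? xs)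
  ... | false = trans (+-suc _ _) (cong suc (length-filter-∁ P? xs))

  Any⇒↭ : {P : A → Set} {xs : List A} → Any P xs → ∃₂ λ y ys → P y × xs ↭ y ∷ ys
  Any⇒↭ p with find p
  ... | y , y∈xs , Py with ∈-∃++ y∈xs
  ... | as , bs , eq = y , _ , Py , ↭-trans (↭-reflexive eq) (shift y as bs)

  -- The witness keeps its own order, unrelated to that of `xs`, so that `P` may describe a path in
  -- order of traversal.
  record HasSubset (P : List A → Set) (xs : List A) : Set where
    constructor hasSubset
    field
      elements : List A
      unique   : Unique elements
      included : All (_∈ xs) elements
      property : P elements

  HasSubset-mono : ∀ {P xs zs} → xs ⊆ zs → HasSubset P xs → HasSubset P zs
  HasSubset-mono xs⊆zs (hasSubset ys u ys⊆ p) = hasSubset ys u (All.map xs⊆zs ys⊆) p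

  module _ {P Q : List A → Set} where

    HasSubset-cons : ∀ {x xs} → All (x ≢_) xs →
                     (∀ {ys} → All (_∈ xs) ys → P ys → Q (x ∷ ys)) →
                     HasSubset P xs → HasSubset Q (x ∷ xs)
    HasSubset-cons x∉xs P⇒Q (hasSubset ys u ys⊆ p) =
      hasSubset _ (All.map (All.lookup x∉xs) ys⊆ ∷ u) (here refl ∷ All.map there ys⊆) (P⇒Q ys⊆ p)

  module _ {B : Set} (_≟_ : DecidableEquality B) (f : A → B) where

    -- Induction on `bs`: when the fibre over `b` has at most `r` elements, discarding it leaves
    -- more than `r` elements per remaining value.
    pigeonhole-list : ∀ r (bs : List B) xs → Unique xs → All (λ x → f x ∈ bs) xs →
                      length bs * r < length xs →
                      ∃ λ b → HasSubset (λ ys → r < length ys × All (λ x → f x ≡ b) ys) xs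
    pigeonhole-list r [] (x ∷ xs) u (() ∷ _) _
    pigeonhole-list r (b ∷ bs) xs u f∈ large
      with suc r ≤? length (filter (λ x → f x ≟ b) xs)
    ... | yes r< = b , hasSubset _ (filter⁺ b? u) (All.tabulate (filter-⊆ b? xs)) (r< , all-filter b? xs)
      where b? = λ x → f x ≟ b
    ... | no r≮ = proj₁ ih , HasSubset-mono (filter-⊆ (∁? b?) xs) (proj₂ ih)
      where
      b? = λ x → f x ≟ b
      rest = filter (∁? b?) xs
      f∈bs : ∀ {x} → f x ∈ b ∷ bs → f x ≢ b → f x ∈ bs
      f∈bs (here eq) neq = contradiction eq neq
      f∈bs (there p) _   = p
      f∈rest : All (λ x → f x ∈ bs) rest
      f∈rest = All.zipWith (λ (p , q) → f∈bs p q)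
                 (anti-mono (filter-⊆ (∁? b?) xs) f∈ , all-filter (∁? b?) xs)
      large′ : length bs * r < length rest
      large′ = +-cancelˡ-< r _ _ (begin-strict
        r + length bs * r                       <⟨ large ⟩
        length xs                               ≡⟨ length-filter-∁ b? xs ⟨
        length (filter b? xs) + length rest     ≤⟨ +-monoˡ-≤ _ (≮⇒≥ r≮) ⟩
        r + length rest                         ∎)
        where open ≤-Reasoning
      ih = pigeonhole-list r bs rest (filter⁺ (∁? b?) u) f∈rest large′

  module _ {R : A → A → Set} where

    AllPairs-lookup : Symmetric R → ∀ {xs} → AllPairs R xs → ∀ i j → i ≢ j →
                      R (lookup xs i) (lookup xs j)
    AllPairs-lookup sy (p ∷ ps) zero    zero    i≢j = contradiction refl i≢j
    AllPairs-lookup sy (p ∷ ps) zero    (suc j) i≢j = All.lookup p (∈-lookup j)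
    AllPairs-lookup sy (p ∷ ps) (suc i) zero    i≢j = sy (AllPairs-lookup sy (p ∷ ps) zero (suc i) λ ())
    AllPairs-lookup sy (p ∷ ps) (suc i) (suc j) i≢j = AllPairs-lookup sy ps i j (i≢j ∘ cong suc)

    Linked-lookup : ∀ {xs} → Linked R xs → ∀ i j → suc (toℕ i) ≡ toℕ j →
                    R (lookup xs i) (lookup xs j)
    Linked-lookup (r ∷ rs) zero    (suc zero) eq = r
    Linked-lookup (r ∷ rs) (suc i) (suc j)    eq = Linked-lookup rs i j (suc-injective eq)

  lookup-injective : ∀ {xs : List A} → Unique xs → Injective _≡_ _≡_ (lookup xs)
  lookup-injective u {i} {j} eq =
    decidable-stable (i Fin.≟ j) λ i≢j → AllPairs-lookup (_∘ sym) u i j i≢j eq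

-- Paths, cycles and independent sets

module _ {A : Set} (_~_ : A → A → Set) where

  Independent : ℕ → List A → Set
  Independent t ys = length ys ≡ t × AllPairs (λ x y → ¬ x ~ y) ys

  PathFrom : A → ℕ → List A → Set
  PathFrom x d ys = length ys ≡ d × Linked _~_ (x ∷ ys)

  Path : ℕ → List A → Set
  Path l ys = length ys ≡ l × Linked _~_ ys

  -- The head `v` is the apex. Read in order, the list is a path that the spoke to its last vertex
  -- closes to a cycle.
  Fan : ℕ → List A → Set
  Fan l []       = ⊥
  Fan l (v ∷ ys) = All (v ~_) ys × Path l ys

-- The recurrence counts what one induction step uses up: a vertex and at most `q * t` of its
-- neighbours.
cycleBound : ℕ → ℕ → ℕ
cycleBound q zero    = 0
cycleBound q (suc t) = suc (cycleBound q t + q * t)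

module _ {A : Set} {_~_ : A → A → Set} (_~?_ : Decidable _~_) where

  independent-cons : ∀ {t v xs} → All (v ≢_) xs → All (λ x → ¬ v ~ x) xs →
                     HasSubset (Independent _~_ t) xs → HasSubset (Independent _~_ (suc t)) (v ∷ xs)
  independent-cons v∉xs v≁xs =
    HasSubset-cons v∉xs λ ys⊆ (len , ind) → cong suc len , All.map (All.lookup v≁xs) ys⊆ ∷ ind

  -- A path that cannot be extended ends in a vertex with no neighbour among the unused vertices.
  extend-path : ∀ {q s} →
    (∀ xs → Unique xs → q * s < length xs →
       HasSubset (Path _~_ (suc q)) xs ⊎ HasSubset (Independent _~_ (suc s)) xs) →
    ∀ d x xs → Unique (x ∷ xs) → q * s + d ≤ length xs →
    HasSubset (PathFrom _~_ x d) xs ⊎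
    (HasSubset (Path _~_ (suc q)) (x ∷ xs) ⊎ HasSubset (Independent _~_ (suc (suc s))) (x ∷ xs))
  extend-path ih zero x xs u large = inj₁ (hasSubset [] [] [] (refl , [-]))
  extend-path {q} {s} ih (suc d) x xs (x∉xs ∷ u) large with any? (x ~?_) xs
  ... | no stuck = inj₂ (Sum.map (HasSubset-mono there)
                                 (independent-cons x∉xs (¬Any⇒All¬ xs stuck))
                                 (ih xs u (≤-trans (m<m+n (q * s) (s≤s z≤n)) large)))
  ... | yes nb with Any⇒↭ nb
  ... | y , ys , x~y , p with Permₛ.Unique-resp-↭ (setoid A) (↭⇒↭ₛ p) u
  ... | u′@(y∉ys ∷ _) =
    Sum.map (HasSubset-mono back ∘ HasSubset-cons y∉ys λ _ (len , l) → cong suc len , x~y ∷ l)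
            (Sum.map (HasSubset-mono (there ∘ back)) (HasSubset-mono (there ∘ back)))
            (extend-path ih d y ys u′ large′)
    where
    back : y ∷ ys ⊆ xs
    back = ∈-resp-↭ (↭-sym p)
    large′ : q * s + d ≤ length ys
    large′ = s≤s⁻¹ (subst₂ _≤_ (+-suc (q * s) d) (↭-length p) large)

  -- Induction on `s`, growing a path from the first vertex: `q` further vertices are wanted, and
  -- `q * suc s` splits into the supply `q * s + q` that `extend-path` asks for.
  path-or-independent : ∀ q s xs → Unique xs → q * s < length xs →
    HasSubset (Path _~_ (suc q)) xs ⊎ HasSubset (Independent _~_ (suc s)) xs
  path-or-independent q zero (x ∷ xs) u large =
    inj₂ (hasSubset (x ∷ []) ([] ∷ []) (here refl ∷ []) (refl , [] ∷ []))
  path-or-independent q (suc s) (x ∷ xs) u@(x∉xs ∷ _) large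
    with extend-path (path-or-independent q s) q x xs u
           (subst (_≤ length xs) (trans (*-suc q s) (+-comm q (q * s))) (s≤s⁻¹ large))
  ... | inj₁ path = inj₁ (HasSubset-cons x∉xs (λ _ (len , l) → cong suc len , l) path)
  ... | inj₂ res  = res

  -- Among many neighbours of `v`, a path makes a fan with apex `v`, and an independent set already
  -- has `suc t` vertices. With few neighbours, at least `cycleBound q t` non-neighbours remain, and
  -- `v` enlarges an independent set of `t` of them.
  fan-or-independent : ∀ q t xs → Unique xs → cycleBound q t ≤ length xs →
    HasSubset (Fan _~_ (suc q)) xs ⊎ HasSubset (Independent _~_ t) xs
  fan-or-independent q zero xs u large = inj₂ (hasSubset [] [] [] (refl , []))
  fan-or-independent q (suc t) (v ∷ xs) (v∉xs ∷ u) large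
    with suc (q * t) ≤? length (filter (v ~?_) xs)
  ... | yes many = Sum.map
    (HasSubset-mono (∷⁺ʳ v nbrs⊆) ∘
      HasSubset-cons (anti-mono nbrs⊆ v∉xs) λ ys⊆ p → All.map (All.lookup (all-filter (v ~?_) xs)) ys⊆ , p)
    (HasSubset-mono (there ∘ nbrs⊆))
    (path-or-independent q t _ (filter⁺ (v ~?_) u) many)
    where nbrs⊆ = filter-⊆ (v ~?_) xs
  ... | no few = Sum.map
    (HasSubset-mono (there ∘ rest⊆))
    (HasSubset-mono (∷⁺ʳ v rest⊆) ∘ independent-cons (anti-mono rest⊆ v∉xs) (all-filter ≁? xs))
    (fan-or-independent q t rest (filter⁺ ≁? u) large′)
    where
    ≁? = ∁? (v ~?_)
    rest = filter ≁? xs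
    rest⊆ = filter-⊆ ≁? xs
    large′ : cycleBound q t ≤ length rest
    large′ = +-cancelʳ-≤ (q * t) _ _ (begin
      cycleBound q t + q * t                      ≤⟨ s≤s⁻¹ large ⟩
      length xs                                   ≡⟨ length-filter-∁ (v ~?_) xs ⟨
      length (filter (v ~?_) xs) + length rest    ≤⟨ +-monoˡ-≤ _ (≮⇒≥ few) ⟩
      q * t + length rest                         ≡⟨ +-comm (q * t) _ ⟩
      length rest + q * t                         ∎)
      where open ≤-Reasoning

-- Colourings

module _ {N k : ℕ} {c : Fin N → Fin N → Fin k} (c-sym : ∀ x y → c x y ≡ c y x) {i : Fin k} where

  private
    _~_ : Fin N → Fin N → Set
    x ~ y = c x y ≡ i

    ~-sym : Symmetric _~_
    ~-sym {x} {y} = trans (c-sym y x)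

    _~?_ : Decidable _~_
    x ~? y = c x y Fin.≟ i

  fan⇒cycle : ∀ {q xs} → HasSubset (Fan _~_ (suc q)) xs → MonoCopy c i (Cycle (suc (suc q)))
  fan⇒cycle (hasSubset (v ∷ y ∷ ys) u _ (v~ , refl , path)) = lookup vs , lookup-injective u , adjacent
    where
    vs = v ∷ y ∷ ys
    linked : Linked _~_ vs
    linked = All.head v~ ∷ path
    adjacent : ∀ a b → CycAdj (length vs) a b → lookup vs a ~ lookup vs b
    adjacent a b (inj₁ eq)                                     = Linked-lookup linked a b eq
    adjacent a b (inj₂ (inj₁ eq))                              = ~-sym (Linked-lookup linked b a eq)
    -- The wrap-around edge is a spoke, since the apex is adjacent to every path vertex.
    adjacent zero (suc b) (inj₂ (inj₂ (inj₁ _)))               = All.lookup v~ (∈-lookup b)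
    adjacent (suc a) zero (inj₂ (inj₂ (inj₂ _)))               = ~-sym (All.lookup v~ (∈-lookup a))

  independent⇒clique : ∀ {t xs} → HasSubset (Independent _~_ t) xs →
    ∃ λ (f : Fin t → Fin N) → Injective _≡_ _≡_ f × (∀ u v → u ≢ v → c (f u) (f v) ≢ i)
  independent⇒clique (hasSubset ys u _ (refl , ind)) =
    lookup ys , lookup-injective u , AllPairs-lookup (_∘ ~-sym) ind

cycle-complete-arrows : ∀ q t →
  Arrows (cycleBound q t) 2 (pair (Cycle (suc (suc q))) (Complete t))
cycle-complete-arrows q t c c-sym
  with fan-or-independent (λ x y → c x y Fin.≟ zero) q t (allFin _) (allFin⁺ _)
         (≤-reflexive (sym (length-tabulate id)))
... | inj₁ fan = zero , fan⇒cycle c-sym fan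
... | inj₂ ind with independent⇒clique c-sym ind
... | f , inj , nonzero = suc zero , f , inj , λ u v u≢v → other (nonzero u v u≢v)
  where
  other : {a : Fin 2} → a ≢ zero → a ≡ suc zero
  other {zero}     a≢0 = contradiction refl a≢0
  other {suc zero} _   = refl

wheel-arrows : ∀ {m k r} →
  Arrows r (suc k) (firstThen (Cycle m) (Wheel (suc m))) →
  Arrows (suc (suc (suc k * (r ∸ 1)))) (suc k) (const (Wheel (suc m)))
wheel-arrows {m} {k} {r} arrows c c-sym
  -- Besides the hub `zero` there are `suc (suc k * (r ∸ 1))` vertices, one too many for each colour
  -- to have at most `r ∸ 1` spokes.
  with pigeonhole-list Fin._≟_ (λ x → c zero (suc x)) (r ∸ 1) (allFin (suc k)) (allFin (suc (suc k * (r ∸ 1))))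
         (allFin⁺ _)
         (All.tabulate (λ _ → ∈-allFin _))
         (subst₂ (λ a b → a * (r ∸ 1) < b) (sym (length-tabulate (id {A = Fin (suc k)})))
                 (sym (length-tabulate (id {A = Fin (suc (suc k * (r ∸ 1)))}))) ≤-refl)
... | i , hasSubset ys u _ (large , spokes) = result (arrows d d-sym)
  where
  r≤ : r ≤ length ys
  -- Truncated subtraction is harmless: `r` is at most `1 + (r ∸ 1)` even when `r` is zero.
  r≤ = ≤-trans (m≤n+m∸n r 1) large

  g : Fin r → Fin _
  g x = suc (lookup ys (inject≤ x r≤))

  g-injective : Injective _≡_ _≡_ g
  g-injective eq = Fin.inject≤-injective r≤ r≤ _ _ (lookup-injective u (Fin.suc-injective eq))

  spoke : ∀ x → c zero (g x) ≡ i
  spoke x = All.lookup spokes (∈-lookup (inject≤ x r≤))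

  -- Exchanges the colours zero and i, so that the cycle of the asymmetric hypothesis gets colour i.
  d : Fin r → Fin r → Fin (suc k)
  d x y = transpose i zero (c (g x) (g y))

  d-sym : ∀ x y → d x y ≡ d y x
  d-sym x y = cong (transpose i zero) (c-sym (g x) (g y))

  undo : ∀ {x y j} → d x y ≡ j → c (g x) (g y) ≡ transpose zero i j
  undo eq = trans (sym (transpose-inverse zero i)) (cong (transpose zero i) eq)

  result : (∃ λ j → MonoCopy d j (firstThen (Cycle m) (Wheel (suc m)) j)) →
           ∃ λ j → MonoCopy c j (Wheel (suc m))
  result (suc j , f , inj , mono) =
    transpose zero i (suc j) , g ∘ f , inj ∘ g-injective , λ a b e → undo (mono a b e)
  -- Colour zero of `d` is colour `i` of `c`, the colour of the spokes, so the hub completes the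
  -- cycle to a wheel.
  result (zero , f , inj , mono) = i , h , h-injective , h-mono
    where
    h : Fin (suc m) → Fin _
    h zero    = zero
    h (suc a) = g (f a)
    h-injective : Injective _≡_ _≡_ h
    h-injective {zero}  {zero}  _  = refl
    h-injective {suc a} {suc b} eq = cong suc (inj (g-injective eq))
    h-mono : ∀ a b → WheelAdj m a b → c (h a) (h b) ≡ i
    h-mono zero    (suc b) _ = spoke (f b)
    h-mono (suc a) zero    _ = trans (c-sym _ _) (spoke (f a))
    -- `transpose zero i zero` computes to `i`.
    h-mono (suc a) (suc b) e = undo (mono a b e)

-- In length one the wrap-around clause of `CycAdj` would be a loop, hence the length of at least
-- two.
cycle-irreflexive : ∀ m u → ¬ CycAdj (suc (suc m)) u u
cycle-irreflexive m u       (inj₁ eq)                          = 1+n≢n eq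
cycle-irreflexive m u       (inj₂ (inj₁ eq))                   = 1+n≢n eq
cycle-irreflexive m zero    (inj₂ (inj₂ (inj₁ (_ , ()))))
cycle-irreflexive m zero    (inj₂ (inj₂ (inj₂ (_ , ()))))

wheel-irreflexive : ∀ m u → ¬ WheelAdj (suc (suc m)) u u
wheel-irreflexive m (suc u) = cycle-irreflexive m u

-- A clique in the merged colour carries only the `suc k` nonzero colours, so `wheels` applies
-- inside it. Irreflexivity of the wheel ensures that its edges land on edges of the clique.
cycle-wheel-arrows : ∀ {m k r s G} →
  Arrows s (suc k) (const (Wheel (suc (suc (suc m))))) →
  Arrows r 2 (pair G (Complete s)) →
  Arrows r (suc (suc k)) (firstThen G (Wheel (suc (suc (suc m)))))
cycle-wheel-arrows {m} {k} {r} {s} {G} wheels arrows c c-sym =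
  result (arrows (λ x y → merge (c x y)) (λ x y → cong merge (c-sym x y)))
  where
  merge : Fin (suc (suc k)) → Fin 2
  merge zero    = zero
  merge (suc _) = suc zero

  lower : Fin (suc (suc k)) → Fin (suc k)
  -- A default value: the colouring passed to `wheels` is total, and colour zero may occur on the
  -- diagonal.
  lower zero    = zero
  lower (suc i) = i

  merge-zero : ∀ {a} → merge a ≡ zero → a ≡ zero
  merge-zero {zero} _ = refl

  suc-lower : ∀ {a i} → merge a ≡ suc zero → lower a ≡ i → a ≡ suc i
  suc-lower {suc a} _ eq = cong suc eq

  result : (∃ λ i → MonoCopy (λ x y → merge (c x y)) i (pair G (Complete s) i)) →
           ∃ λ i → MonoCopy c i (firstThen G (Wheel (suc (suc (suc m)))) i)
  result (zero , f , inj , mono) = zero , f , inj , λ a b e → merge-zero (mono a b e)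
  result (suc zero , f , inj , mono)
    with wheels (λ x y → lower (c (f x) (f y))) (λ x y → cong lower (c-sym (f x) (f y)))
  ... | i , g , g-inj , g-mono = suc i , f ∘ g , g-inj ∘ inj , λ a b e →
    suc-lower (mono (g a) (g b) (distinct e ∘ g-inj)) (g-mono a b e)
    where
    distinct : ∀ {a b} → WheelAdj (suc (suc m)) a b → a ≢ b
    distinct e refl = wheel-irreflexive m _ e

-- Closed form of the bound, and the three inequalities

cycleBound-closed : ∀ q t → cycleBound q t ≡ (q * (t * (t ∸ 1))) / 2 + t
cycleBound-closed q t = begin
  cycleBound q t                     ≡⟨ cycleBound-triangle t ⟩
  q * triangle t + t                 ≡⟨ cong (_+ t) (m*n/n≡m (q * triangle t) 2) ⟨
  q * triangle t * 2 / 2 + t         ≡⟨ cong (λ a → a / 2 + t) (*-assoc q (triangle t) 2) ⟩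
  q * (triangle t * 2) / 2 + t       ≡⟨ cong (λ a → q * a / 2 + t) (triangle-double t) ⟩
  q * (t * (t ∸ 1)) / 2 + t          ∎
  where
  open ≡-Reasoning
  -- This is `t` choose 2. Its double is `t * (t ∸ 1)`, which makes the division by 2 exact.
  triangle : ℕ → ℕ
  triangle zero    = 0
  triangle (suc t) = triangle t + t

  cycleBound-triangle : ∀ t → cycleBound q t ≡ q * triangle t + t
  cycleBound-triangle zero    = sym (trans (+-identityʳ _) (*-zeroʳ q))
  cycleBound-triangle (suc t) rewrite cycleBound-triangle t = regroup q (triangle t) t
    where
    regroup : ∀ q a t → suc (q * a + t + q * t) ≡ q * (a + t) + suc t
    regroup = solve-∀

  triangle-double : ∀ t → triangle t * 2 ≡ t * (t ∸ 1)
  triangle-double zero          = refl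
  triangle-double (suc zero)    = refl
  triangle-double (suc (suc t)) =
    trans (*-distribʳ-+ 2 (triangle (suc t)) (suc t))
          (trans (cong (_+ suc t * 2) (triangle-double (suc t))) (regroup t))
    where
    regroup : ∀ t → suc t * t + suc t * 2 ≡ suc (suc t) * suc t
    regroup = solve-∀

theorem1p7 : (k n : ℕ) → 2 ≤ k → 4 ≤ n →
    (rk rCW rCK r1 : ℕ) →
    IsRamsey k (const (Wheel n)) rk →
    IsRamsey k (firstThen (Cycle (n ∸ 1)) (Wheel n)) rCW →
    IsRamsey (k ∸ 1) (const (Wheel n)) r1 →
    IsRamsey 2 (pair (Cycle (n ∸ 1)) (Complete r1)) rCK →
    (rk ≤ k * (rCW ∸ 1) + 2)
    × (k * (rCW ∸ 1) + 2 ≤ k * (rCK ∸ 1) + 2)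
    × (rk ≤ k * (((n ∸ 3) * (r1 * (r1 ∸ 1))) / 2 + r1 ∸ 1) + 2)
-- With `n` equal to `q + 3`, the rim has length `q + 2` and `n ∸ 3` is the `q` of `cycleBound`.
theorem1p7 (suc (suc k)) (suc (suc (suc q))) (s≤s (s≤s _)) (s≤s (s≤s (s≤s _))) rk rCW rCK r1
  (_ , rk-min) (rCW-arrows , rCW-min) (r1-arrows , _) (rCK-arrows , rCK-min) =
  rk≤ , mono rCW≤rCK , ≤-trans rk≤ (mono (≤-trans rCW≤rCK rCK≤))
  where
  K = suc (suc k)

  mono : ∀ {a b} → a ≤ b → K * (a ∸ 1) + 2 ≤ K * (b ∸ 1) + 2
  mono a≤b = +-monoˡ-≤ 2 (*-monoʳ-≤ K (∸-monoˡ-≤ 1 a≤b))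

  rk≤ : rk ≤ K * (rCW ∸ 1) + 2
  rk≤ = subst (rk ≤_) (+-comm 2 _) (rk-min _ (wheel-arrows rCW-arrows))

  rCW≤rCK : rCW ≤ rCK
  rCW≤rCK = rCW-min rCK (cycle-wheel-arrows r1-arrows rCK-arrows)

  rCK≤ : rCK ≤ (q * (r1 * (r1 ∸ 1))) / 2 + r1
  rCK≤ = subst (rCK ≤_) (cycleBound-closed q r1) (rCK-min _ (cycle-complete-arrows q r1))
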